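{- Let $G$ be a graph of order $n \geq 2$, and let $\overline{G}$ be its complement. Then $$4 \leq b_{\rm g}'(G) + b_{\rm g}'(\overline{G}) \leq n+2.$$
   Context: All graphs are finite, simple and undirected; the order of a graph is its number of vertices. The burning game on a graph $G$ is played by two players, Burner and Staller, in rounds $t=1,2,3,\dots$. Initially (round $0$) all vertices are unburned. Each round $t\ge 1$ consists of two phases: first, in the spreading phase, every unburned vertex having a burning neighbor starts to burn (fire spreads simultaneously, by distance one, from all burning vertices); then, in the selection phase, if unburned vertices remain, the player whose turn it is chooses one unburned vertex, which starts to burn. Burning vertices stay burning forever. The players alternate: one of them selects in the odd rounds, the other in the even rounds. The game ends in the first round in which all vertices of $G$ are burning (possibly already after the spreading phase of that round). Burner wants to minimize the number of rounds and Staller wants to maximize it. If both play optimally, the number of rounds is denoted $b_{\rm g}'(G)$ (the Staller-start game burning number) when Staller makes the first move (selects in round 1). -}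

module Defs where

open import Data.Empty using (⊥-elim)
open import Data.Fin.Base using (Fin)
open import Data.Fin.Properties using (any?) renaming (_≟_ to _≟ᶠ_)
open import Data.Fin.Subset
open import Data.Fin.Subset.Properties
open import Data.List.Base using (List; []; _∷_; map; filter; allFin)
open import Data.List.Extrema.Nat using (min; max)
open import Data.List.Membership.Propositional using () renaming (_∈_ to _∈ˡ_)
open import Data.List.Membership.Propositional.Properties using (∈-filter⁻)
open import Data.List.Properties using (map-cong-local)
open import Data.List.Relation.Unary.All using (All; []; _∷_)
import Data.List.Relation.Unary.All as All
open import Data.List.Relation.Unary.Any using (here)
open import Data.Nat.Base using (ℕ; zero; suc; _+_; _≤_; _<_; s≤s⁻¹)
open import Data.Nat.Properties using (≤-trans; m≤n+m; n≮0)
open import Data.Product.Base using (∃-syntax; _×_; _,_; proj₂)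
open import Data.Sum.Base using (_⊎_; inj₁)
open import Data.Vec.Base using (tabulate)
open import Data.Vec.Properties using (lookup∘tabulate; lookup⇒[]=)
open import Level using (0ℓ)
open import Relation.Binary.Core using (Rel)
open import Relation.Binary.Definitions using (Symmetric; Irreflexive; Decidable)
open import Relation.Binary.PropositionalEquality
open import Relation.Nullary using (Dec; does; ¬_)
open import Relation.Nullary.Decidable using (¬?; _×-dec_; _⊎-dec_; dec-true)

record Graph (n : ℕ) : Set₁ where
  field
    Adj     : Rel (Fin n) 0ℓ
    adj?    : Decidable Adj
    symm    : Symmetric Adj
    irrefl  : Irreflexive _≡_ Adj

complement : ∀ {n} → Graph n → Graph n
complement G = record
  { Adj    = λ u v → u ≢ v × ¬ Adj u v
  ; adj?   = λ u v → ¬? (u ≟ᶠ v) ×-dec ¬? (adj? u v)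
  ; symm   = λ { (u≢v , ¬uv) → (λ v≡u → u≢v (sym v≡u)) , (λ vu → ¬uv (symm vu)) }
  ; irrefl = λ { u≡v (u≢v , _) → u≢v u≡v }
  }
  where open Graph G

data Player : Set where
  Burner Staller : Player

opponent : Player → Player
opponent Burner  = Staller
opponent Staller = Burner

-- The value preferred by a player among x and the members of xs.
best : Player → ℕ → List ℕ → ℕ
best Burner  x xs = min x xs
best Staller x xs = max x xs

unburned : ∀ {n} → Subset n → List (Fin n)
unburned S = filter (λ v → ¬? (v ∈? S)) (allFin _)

module _ {n : ℕ} (G : Graph n) where
  open Graph G

  catchesFire? : (S : Subset n) (v : Fin n) →
                 Dec (v ∈ S ⊎ (∃[ u ] u ∈ S × Adj u v))
  catchesFire? S v = (v ∈? S) ⊎-dec any? (λ u → (u ∈? S) ×-dec adj? u v)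

  spread : Subset n → Subset n
  spread S = tabulate (λ v → does (catchesFire? S v))

  -- rounds k p S is the number of rounds still to be played, under optimal
  -- play, when S is the set of burning vertices at the end of a round and p
  -- selects in the next round; play is cut off after k more rounds.
  -- The cut-off only serves termination: see rounds-stable.
  --
  -- select k p T L is the number of rounds played after the current one, when
  -- the fire has just spread to T, p is to select, and L lists the vertices
  -- outside T.
  mutual
    rounds : ℕ → Player → Subset n → ℕ
    rounds zero    p S = 0
    rounds (suc k) p S = roundsFrom k p S (unburned S)

    roundsFrom : ℕ → Player → Subset n → List (Fin n) → ℕ
    roundsFrom k p S []      = 0
    roundsFrom k p S (_ ∷ _) = suc (select k p (spread S) (unburned (spread S)))

    select : ℕ → Player → Subset n → List (Fin n) → ℕ
    select k p T []       = 0
    select k p T (v ∷ vs) = best p (after v) (map after vs)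
      where
      after : Fin n → ℕ
      after w = rounds k (opponent p) (T ∪ ⁅ w ⁆)

  -- Every round burns at least one new vertex, so n rounds suffice.
  b′g : ℕ
  b′g = rounds n Staller ⊥

  private
    ∈unburned⇒∉ : ∀ {S : Subset n} {v} → v ∈ˡ unburned S → v ∉ S
    ∈unburned⇒∉ {S} v∈ = proj₂ (∈-filter⁻ (λ v → ¬? (v ∈? S)) {xs = allFin n} v∈)

    ⊆spread : ∀ S → S ⊆ spread S
    ⊆spread S {v} v∈S = lookup⇒[]= v (spread S)
      (trans (lookup∘tabulate _ v) (dec-true (catchesFire? S v) (inj₁ v∈S)))

    shrinks : ∀ {S v} → v ∉ spread S → ∣ ∁ (spread S ∪ ⁅ v ⁆) ∣ < ∣ ∁ S ∣
    shrinks {S} {v} v∉ = p⊂q⇒∣p∣<∣q∣ (p⊂q⇒∁p⊃∁q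
      ( (λ x∈S → p⊆p∪q ⁅ v ⁆ (⊆spread S x∈S))
      , v , q⊆p∪q (spread S) ⁅ v ⁆ (x∈⁅x⁆ v) , λ v∈S → v∉ (⊆spread S v∈S)))

    rounds-suc : ∀ k p S → ∣ ∁ S ∣ ≤ k → rounds (suc k) p S ≡ rounds k p S
    rounds-suc zero p S le = go (unburned S) refl
      where
      go : ∀ L → L ≡ unburned S → roundsFrom 0 p S L ≡ 0
      go []      _  = refl
      go (v ∷ L) eq = ⊥-elim (n≮0 (≤-trans
        (x∈p⇒∣p-x∣<∣p∣ (x∉p⇒x∈∁p (∈unburned⇒∉ (subst (v ∈ˡ_) eq (here refl))))) le))
    rounds-suc (suc k) p S le = go (unburned S)
      where
      T = spread S

      step : ∀ {v} → v ∉ T →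
             rounds (suc k) (opponent p) (T ∪ ⁅ v ⁆) ≡ rounds k (opponent p) (T ∪ ⁅ v ⁆)
      step v∉ = rounds-suc k (opponent p) _ (s≤s⁻¹ (≤-trans (shrinks v∉) le))

      sel : ∀ L → All (_∉ T) L → select (suc k) p T L ≡ select k p T L
      sel []      _         = refl
      sel (v ∷ L) (v∉ ∷ L∉) = cong₂ (best p) (step v∉) (map-cong-local (All.map step L∉))

      go : ∀ L → roundsFrom (suc k) p S L ≡ roundsFrom k p S L
      go []      = refl
      go (_ ∷ _) = cong suc (sel (unburned T) (All.tabulate ∈unburned⇒∉))

  rounds-stable : ∀ j p S → rounds (j + n) p S ≡ rounds n p S
  rounds-stable zero    p S = refl
  rounds-stable (suc j) p S = trans
    (rounds-suc (j + n) p S (≤-trans (∣p∣≤n (∁ S)) (m≤n+m n j)))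
    (rounds-stable j p S)

{-# OPTIONS --safe #-}
-- For every graph, either it has diameter at most 2, or two of its vertices are
-- non-adjacent without a common neighbour and hence form a dominating edge of the
-- complement.  Either property forces the game to end within 3 rounds: in the second
-- case an end of the dominating edge burns after the spreading phase of round 2
-- and Burner can make sure that the other one burns at the end of that round.
-- So one of the two graphs needs at most 3 rounds.  If n ≥ 4 and the other graph has
-- an edge, Burner saves a round on it by burning an end of the edge, so that it needs at
-- most n - 1 rounds; if it has no edge, the first graph is complete and needs
-- only 2 rounds.  For n ≤ 3, one of the two graphs has no isolated vertex and
-- needs only 2 rounds.
module Submission where

open import Defs
open import Data.Nat using (ℕ; _+_; _≤_)
open import Data.Product using (_×_)

open import Data.Fin.Base using (Fin; zero; suc)
open import Data.Fin.Properties using (any?; all?) renaming (_≟_ to _≟ᶠ_)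
open import Data.Fin.Subset
open import Data.Fin.Subset.Properties
open import Data.List.Base using ([]; _∷_; map; allFin)
open import Data.List.Extrema.Nat using (min≤v⁺; max≤v⁺; v≤max⁺)
open import Data.List.Membership.Propositional using () renaming (_∈_ to _∈ˡ_)
open import Data.List.Membership.Propositional.Properties
  using (∈-filter⁺; ∈-filter⁻; ∈-allFin)
open import Data.List.Relation.Unary.Any using (here; there)
import Data.List.Relation.Unary.Any as Any
import Data.List.Relation.Unary.Any.Properties as Any
import Data.List.Relation.Unary.All as All
import Data.List.Relation.Unary.All.Properties as All
open import Data.Nat.Base using (zero; suc; z≤n; s≤s; _∸_; _<_)
open import Data.Nat.Properties
  using (≤-trans; ≤-reflexive; +-comm; +-mono-≤; ∸-monoʳ-≤; m≤n⇒m<n∨m≡n; +-∸-assoc;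
         m+[n∸m]≡n; m≤n⇒m∸n≡0; _≤?_; ≰⇒>)
open import Data.Product using (∃-syntax; _,_; proj₂)
open import Data.Sum.Base using (_⊎_; inj₁; inj₂; swap)
open import Data.Vec.Properties using (lookup∘tabulate; lookup⇒[]=; []=⇒lookup)
open import Function.Base using (_∘_)
open import Relation.Binary.PropositionalEquality
open import Relation.Nullary using (yes; no; ¬_; contradiction)
open import Relation.Nullary.Decidable using (¬?; _×-dec_; dec-true; dec-false)

private
  variable
    n k j m : ℕ
    S T : Subset n
    v w : Fin n

-- Burning sets and best moves.

∈unburned⇒∉ : v ∈ˡ unburned S → v ∉ S
∈unburned⇒∉ {S = S} v∈ = proj₂ (∈-filter⁻ (λ v → ¬? (v ∈? S)) {xs = allFin _} v∈)

∉⇒∈unburned : v ∉ S → v ∈ˡ unburned S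
∉⇒∈unburned {S = S} v∉ = ∈-filter⁺ (λ v → ¬? (v ∈? S)) (∈-allFin _) v∉

∈∪⁅⁆ : v ∈ T ∪ ⁅ v ⁆
∈∪⁅⁆ {v = v} {T = T} = q⊆p∪q T ⁅ v ⁆ (x∈⁅x⁆ v)

∣p∣<∣p∪⁅v⁆∣ : v ∉ T → ∣ T ∣ < ∣ T ∪ ⁅ v ⁆ ∣
∣p∣<∣p∪⁅v⁆∣ {v = v} v∉ = p⊂q⇒∣p∣<∣q∣ (p⊆p∪q ⁅ v ⁆ , v , ∈∪⁅⁆ , v∉)

∪⁅⁆-⊆ : S ⊆ T → v ∈ T → S ∪ ⁅ v ⁆ ⊆ T
∪⁅⁆-⊆ {S = S} {T} {v} S⊆T v∈T x∈ with x∈p∪q⁻ S ⁅ v ⁆ x∈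
... | inj₁ x∈S = S⊆T x∈S
... | inj₂ x∈v = subst (_∈ T) (sym (x∈⁅y⁆⇒x≡y v x∈v)) v∈T

two-elements : {a b : Fin n} → a ≢ b → a ∈ T → b ∈ T → 2 ≤ ∣ T ∣
two-elements {a = a} {b} a≢b a∈ b∈ = ≤-trans
  (≤-trans (s≤s (≤-reflexive (sym (∣⁅x⁆∣≡1 a))))
           (∣p∣<∣p∪⁅v⁆∣ (x≢y⇒x∉⁅y⁆ (a≢b ∘ sym))))
  (p⊆q⇒∣p∣≤∣q∣ (∪⁅⁆-⊆ (λ x∈ → subst (_∈ _) (sym (x∈⁅y⁆⇒x≡y a x∈)) a∈) b∈))

three-elements : {a b c : Fin n} → a ≢ b → a ≢ c → b ≢ c →
                 a ∈ T → b ∈ T → c ∈ T → 3 ≤ ∣ T ∣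
three-elements {T = T} {a} {b} {c} a≢b a≢c b≢c a∈ b∈ c∈ = ≤-trans
  (s≤s (two-elements {T = T - c} a≢b (x∈p∧x≢y⇒x∈p-y a∈ a≢c) (x∈p∧x≢y⇒x∈p-y b∈ b≢c)))
  (x∈p⇒∣p-x∣<∣p∣ c∈)

other : 2 ≤ n → (v : Fin n) → ∃[ u ] u ≢ v
other (s≤s (s≤s _)) zero    = suc zero , λ ()
other (s≤s (s≤s _)) (suc v) = zero , λ ()

best-≤ : ∀ p (f : Fin n → ℕ) v vs → (∀ {w} → w ∈ˡ v ∷ vs → f w ≤ j) →
         best p (f v) (map f vs) ≤ j
best-≤ Burner  f v vs f≤ = min≤v⁺ _ (map f vs) (inj₁ (f≤ (here refl)))
best-≤ Staller f v vs f≤ = max≤v⁺ (f≤ (here refl)) (All.map⁺ (All.tabulate (f≤ ∘ there)))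

best-Burner-≤ : (f : Fin n → ℕ) → ∀ v vs → w ∈ˡ v ∷ vs → f w ≤ j →
                best Burner (f v) (map f vs) ≤ j
best-Burner-≤ f v vs (here refl) fw≤ = min≤v⁺ _ (map f vs) (inj₁ fw≤)
best-Burner-≤ f v vs (there w∈)  fw≤ =
  min≤v⁺ _ (map f vs) (inj₂ (Any.map⁺ (Any.map (λ { refl → fw≤ }) w∈)))

-- Playing rounds on a single graph.

module _ {n : ℕ} (G : Graph n) where
  open Graph G

  ∈spread⁺ : v ∈ S ⊎ (∃[ u ] u ∈ S × Adj u v) → v ∈ spread G S
  ∈spread⁺ {v} {S} c = lookup⇒[]= v (spread G S)
    (trans (lookup∘tabulate _ v) (dec-true (catchesFire? G S v) c))

  ⊆spread : S ⊆ spread G S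
  ⊆spread = ∈spread⁺ ∘ inj₁

  adj∈spread : ∀ {u v} → u ∈ S → Adj u v → v ∈ spread G S
  adj∈spread u∈ uv = ∈spread⁺ (inj₂ (_ , u∈ , uv))

  ∉spread-⊥ : v ∉ spread G ⊥
  ∉spread-⊥ {v} v∈ = contradiction
    (trans (sym (dec-false (catchesFire? G ⊥ v) unlit))
           (trans (sym (lookup∘tabulate _ v)) ([]=⇒lookup v∈)))
    λ ()
    where
    unlit : ¬ (v ∈ ⊥ ⊎ (∃[ u ] u ∈ ⊥ × Adj u v))
    unlit (inj₁ v∈⊥)           = ∉⊥ v∈⊥
    unlit (inj₂ (u , u∈⊥ , _)) = ∉⊥ u∈⊥

  roundsFrom-≤ : ∀ p S L → select G k p (spread G S) (unburned (spread G S)) ≤ j →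
                 roundsFrom G k p S L ≤ suc j
  roundsFrom-≤ p S []      _ = z≤n
  roundsFrom-≤ p S (_ ∷ _) h = s≤s h

  select-≤ : ∀ p T L → (∀ {v} → v ∈ˡ L → rounds G k (opponent p) (T ∪ ⁅ v ⁆) ≤ j) →
             select G k p T L ≤ j
  select-≤ p T []      h = z≤n
  select-≤ p T (v ∷ L) h = best-≤ p _ v L h

  select-Burner-≤ : ∀ T L → v ∈ˡ L → rounds G k Staller (T ∪ ⁅ v ⁆) ≤ j →
                    select G k Burner T L ≤ j
  select-Burner-≤ T (v ∷ L) = best-Burner-≤ _ v L

  -- A record rather than a function, so that p and S can be inferred.
  record EndsWithin (j : ℕ) (p : Player) (S : Subset n) : Set where
    constructor endsWithin
    field
      bound : ∀ k → rounds G k p S ≤ j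
  open EndsWithin public

  -- A common bound for all moves bounds the minimum as well as the maximum, so this serves both
  -- players.
  endsWithin-suc : ∀ {p} →
    (∀ {v} → v ∉ spread G S → EndsWithin j (opponent p) (spread G S ∪ ⁅ v ⁆)) →
    EndsWithin (suc j) p S
  endsWithin-suc         h .bound zero    = z≤n
  endsWithin-suc {S = S} h .bound (suc k) = roundsFrom-≤ _ S (unburned S)
    (select-≤ _ _ _ (λ v∈ → h (∈unburned⇒∉ v∈) .bound k))

  -- Burner can make sure that a given vertex burns at the end of the round:
  -- either the fire reaches it or Burner selects it.
  Burner-burns : ∀ v → (∀ {T} → spread G S ⊆ T → v ∈ T → EndsWithin j Staller T) →
                 EndsWithin (suc j) Burner S
  Burner-burns {S = S} v h with v ∈? spread G S
  ... | yes v∈ = endsWithin-suc (λ {x} _ → h (p⊆p∪q ⁅ x ⁆) (p⊆p∪q ⁅ x ⁆ v∈))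
  ... | no  v∉ = endsWithin λ where
    zero    → z≤n
    (suc k) → roundsFrom-≤ _ S (unburned S)
      (select-Burner-≤ _ _ (∉⇒∈unburned v∉) (h (p⊆p∪q ⁅ v ⁆) ∈∪⁅⁆ .bound k))

  covered⇒endsWithin-1 : ∀ {p} → (∀ v → v ∈ spread G S) → EndsWithin 1 p S
  covered⇒endsWithin-1 full = endsWithin-suc (λ v∉ → contradiction (full _) v∉)

  -- Each round leaves fewer unburned vertices, whoever selects and however badly.
  rounds≤n∸∣S∣ : ∀ k {p} S → rounds G k p S ≤ n ∸ ∣ S ∣
  rounds≤n∸∣S∣ zero    S = z≤n
  rounds≤n∸∣S∣ (suc k) {p} S with m≤n⇒m<n∨m≡n (∣p∣≤n S)
  ... | inj₁ ∣S∣<n = ≤-trans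
    (roundsFrom-≤ p S (unburned S) (select-≤ p (spread G S) _ λ {v} v∈ → ≤-trans
      (rounds≤n∸∣S∣ k (spread G S ∪ ⁅ v ⁆))
      (∸-monoʳ-≤ n (≤-trans (s≤s (p⊆q⇒∣p∣≤∣q∣ (⊆spread {S = S})))
                            (∣p∣<∣p∪⁅v⁆∣ (∈unburned⇒∉ {S = spread G S} v∈))))))
    (≤-reflexive (sym (+-∸-assoc 1 ∣S∣<n)))
  -- Subtraction truncates here, so counting one round against one vertex fails; instead, no round
  -- is left to play.
  ... | inj₂ ∣S∣≡n = none (unburned S) refl
    where
    none : ∀ L → L ≡ unburned S → roundsFrom G k p S L ≤ n ∸ ∣ S ∣
    none []      _  = z≤n
    none (v ∷ L) eq = contradiction
      (subst (v ∈_) (sym (∣p∣≡n⇒p≡⊤ ∣S∣≡n)) ∈⊤)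
      (∈unburned⇒∉ {S = S} (subst (v ∈ˡ_) eq (here refl)))

  -- The current round burns the `m` vertices and one selected vertex; each vertex left costs at
  -- most one more round.
  endsWithin-spread : ∀ {p} → m ≤ ∣ spread G S ∣ → EndsWithin (suc (n ∸ suc m)) p S
  endsWithin-spread m≤ = endsWithin-suc λ v∉ → endsWithin λ k → ≤-trans (rounds≤n∸∣S∣ k _)
    (∸-monoʳ-≤ n (≤-trans (s≤s m≤) (∣p∣<∣p∪⁅v⁆∣ v∉)))

  b′g≤n : b′g G ≤ n
  b′g≤n = ≤-trans (rounds≤n∸∣S∣ n ⊥) (≤-reflexive (cong (n ∸_) (∣⊥∣≡0 n)))

  -- Here `S` is the burning set after round 1, of which only Staller's first vertex `w` is
  -- remembered.
  b′g-≤ : (∀ w {S} → w ∈ S → EndsWithin j Burner S) → b′g G ≤ suc j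
  b′g-≤ h = endsWithin-suc (λ {v} _ → h v ∈∪⁅⁆) .bound n

  -- Upper bounds from the structure of the graph.

  Complete : Set
  Complete = ∀ {u v} → u ≢ v → Adj u v

  complete⇒b′g≤2 : Complete → b′g G ≤ 2
  complete⇒b′g≤2 complete = b′g-≤ λ w w∈ → covered⇒endsWithin-1 (reach w w∈)
    where
    reach : ∀ w {S} → w ∈ S → ∀ v → v ∈ spread G S
    reach w w∈ v with w ≟ᶠ v
    ... | yes refl = ⊆spread w∈
    ... | no  w≢v  = adj∈spread w∈ (complete w≢v)

  -- Distance at most 2.
  Near : Fin n → Fin n → Set
  Near u v = u ≡ v ⊎ Adj u v ⊎ (∃[ w ] Adj u w × Adj w v)

  -- Fire from Staller's first vertex reaches everything in the spreading phases of rounds 2 and 3,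
  -- whatever Burner selects in between.
  near⇒b′g≤3 : (∀ u v → Near u v) → b′g G ≤ 3
  near⇒b′g≤3 near = b′g-≤ λ w w∈ → endsWithin-suc λ {x} _ →
    covered⇒endsWithin-1 (reach (p⊆p∪q ⁅ x ⁆) w∈ ∘ near w)
    where
    reach : ∀ {w v} → spread G S ⊆ T → w ∈ S → Near w v → v ∈ spread G T
    reach ⊆T w∈ (inj₁ refl)                   = ⊆spread (⊆T (⊆spread w∈))
    reach ⊆T w∈ (inj₂ (inj₁ wv))              = ⊆spread (⊆T (adj∈spread w∈ wv))
    reach ⊆T w∈ (inj₂ (inj₂ (u , wu , uv)))   = adj∈spread (⊆T (adj∈spread w∈ wu)) uv

  DominatingEdge : Fin n → Fin n → Set
  DominatingEdge u v = Adj u v × (∀ w → (u ≡ w ⊎ Adj u w) ⊎ (v ≡ w ⊎ Adj v w))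

  dominatingEdge⇒b′g≤3 : ∀ {u v} → DominatingEdge u v → b′g G ≤ 3
  dominatingEdge⇒b′g≤3 {u} {v} (uv , dom) = b′g-≤ λ w w∈ → reply (dom w) w∈
    where
    near : ∀ {x y} → x ∈ S → x ≡ y ⊎ Adj x y → y ∈ spread G S
    near x∈ (inj₁ refl) = ⊆spread x∈
    near x∈ (inj₂ xy)   = adj∈spread x∈ xy

    near⁻ : ∀ {x y} → y ∈ S → x ≡ y ⊎ Adj x y → x ∈ spread G S
    near⁻ y∈ (inj₁ refl) = ⊆spread y∈
    near⁻ y∈ (inj₂ xy)   = adj∈spread y∈ (symm xy)

    reach : ∀ {x} → u ∈ S → v ∈ S →
            (u ≡ x ⊎ Adj u x) ⊎ (v ≡ x ⊎ Adj v x) → x ∈ spread G S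
    reach u∈ v∈ (inj₁ ux) = near u∈ ux
    reach u∈ v∈ (inj₂ vx) = near v∈ vx

    reply : ∀ {w} → (u ≡ w ⊎ Adj u w) ⊎ (v ≡ w ⊎ Adj v w) → w ∈ S → EndsWithin 2 Burner S
    reply (inj₁ uw) w∈ = Burner-burns v λ ⊆T v∈ →
      covered⇒endsWithin-1 (reach (⊆T (near⁻ w∈ uw)) v∈ ∘ dom)
    reply (inj₂ vw) w∈ = Burner-burns u λ ⊆T u∈ →
      covered⇒endsWithin-1 (reach u∈ (⊆T (near⁻ w∈ vw)) ∘ dom)

  NoIsolated : Set
  NoIsolated = ∀ v → ∃[ u ] Adj v u

  adj⇒≢ : ∀ {u v} → Adj u v → u ≢ v
  adj⇒≢ uv u≡v = irrefl u≡v uv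

  edge⇒2≤∣spread∣ : ∀ {u v} → u ∈ S → Adj u v → 2 ≤ ∣ spread G S ∣
  edge⇒2≤∣spread∣ u∈ uv = two-elements (adj⇒≢ uv) (⊆spread u∈) (adj∈spread u∈ uv)

  -- Staller's first vertex ignites a neighbor in round 2. For `n ≤ 3` the truncated subtraction
  -- makes the bound 2.
  noIsolated⇒b′g≤ : NoIsolated → b′g G ≤ 2 + (n ∸ 3)
  noIsolated⇒b′g≤ nbr = b′g-≤ λ w w∈ →
    endsWithin-spread (edge⇒2≤∣spread∣ w∈ (proj₂ (nbr w)))

  edge⇒b′g≤ : ∀ {a b} → 4 ≤ n → Adj a b → b′g G ≤ 3 + (n ∸ 4)
  edge⇒b′g≤ {a} {b} 4≤n ab = b′g-≤ reply
    where
    ends : ∀ {S} → 2 ≤ ∣ spread G S ∣ → EndsWithin (2 + (n ∸ 4)) Burner S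
    ends {S} = subst (λ i → EndsWithin (suc i) Burner S) (+-∸-assoc 1 4≤n) ∘ endsWithin-spread

    reply : ∀ w {S} → w ∈ S → EndsWithin (2 + (n ∸ 4)) Burner S
    reply w w∈ with w ≟ᶠ a | w ≟ᶠ b
    -- If Staller opens at an end of the edge, the round is saved already in the spreading phase of
    -- round 2.
    ... | yes refl | _        = ends (edge⇒2≤∣spread∣ w∈ ab)
    ... | no _     | yes refl = ends (edge⇒2≤∣spread∣ w∈ (symm ab))
    -- With `w` and `a` burning after round 2, the fire reaches `b` in round 3: three vertices burn
    -- before Staller selects.
    ... | no w≢a   | no w≢b   = Burner-burns a λ ⊆T a∈ →
      endsWithin-spread (three-elements w≢a w≢b (adj⇒≢ ab)
        (⊆spread (⊆T (⊆spread w∈))) (⊆spread a∈) (adj∈spread a∈ ab))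

-- Lower bound.

-- Nothing spreads in round 1, so only Staller's vertex burns after it and some other vertex forces
-- a second round.
2≤b′g : (G : Graph n) → 2 ≤ n → 2 ≤ b′g G
2≤b′g {suc (suc n)} G 2≤n@(s≤s (s≤s z≤n)) = first (unburned ⊥) (∉⇒∈unburned {v = zero} ∉⊥)
  where
  -- The game is defined by cases on the list of unburned vertices; a member of it excludes the
  -- empty case.
  second : ∀ S L → v ∈ˡ L → 1 ≤ roundsFrom G n Burner S L
  second S (_ ∷ _) _ = s≤s z≤n

  answer : ∀ v → 1 ≤ rounds G (suc n) Burner (spread G ⊥ ∪ ⁅ v ⁆)
  answer v with other 2≤n v
  ... | u , u≢v = second _ _ (∉⇒∈unburned u∉)
    where
    u∉ : u ∉ spread G ⊥ ∪ ⁅ v ⁆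
    u∉ u∈ with x∈p∪q⁻ (spread G ⊥) ⁅ v ⁆ u∈
    ... | inj₁ u∈⊥ = ∉spread-⊥ G u∈⊥
    ... | inj₂ u∈v = u≢v (x∈⁅y⁆⇒x≡y v u∈v)

  choose : ∀ L → v ∈ˡ L → 1 ≤ select G (suc n) Staller (spread G ⊥) L
  -- The default value of `max` is the value of the move `v`, so bounding that move suffices.
  choose (v ∷ L) _ = v≤max⁺ _ (map _ L) (inj₁ (answer v))

  first : ∀ L → v ∈ˡ L → 2 ≤ roundsFrom G (suc n) Staller ⊥ L
  first (_ ∷ _) _ = s≤s (choose (unburned (spread G ⊥)) (∉⇒∈unburned {v = zero} (∉spread-⊥ G)))

-- Upper bound for the sum.

-- The only part of complementarity that matters for the upper bound, and unlike
-- "H is the complement of G" it is symmetric in G and H.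
Cover : Graph n → Graph n → Set
Cover G H = ∀ {u v} → u ≢ v → Graph.Adj G u v ⊎ Graph.Adj H u v

cover-complement : (G : Graph n) → Cover G (complement G)
cover-complement G {u} {v} u≢v with Graph.adj? G u v
... | yes uv = inj₁ uv
... | no ¬uv = inj₂ (u≢v , ¬uv)

module _ (G H : Graph n) (cover : Cover G H) where
  private
    module G = Graph G
    module H = Graph H

  b′g≤3⊎b′g≤3 : b′g G ≤ 3 ⊎ b′g H ≤ 3
  b′g≤3⊎b′g≤3
    with any? (λ u → any? λ v → ¬? (u ≟ᶠ v) ×-dec ¬? (G.adj? u v)
                       ×-dec ¬? (any? λ w → G.adj? u w ×-dec G.adj? w v))
  ... | yes (u , v , u≢v , ¬uv , ¬common) =
    inj₂ (dominatingEdge⇒b′g≤3 H (fromCover u≢v ¬uv , dom))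
    where
    fromCover : ∀ {x y} → x ≢ y → ¬ G.Adj x y → H.Adj x y
    fromCover x≢y ¬xy with cover x≢y
    ... | inj₁ xy = contradiction xy ¬xy
    ... | inj₂ xy = xy

    dom : ∀ w → (u ≡ w ⊎ H.Adj u w) ⊎ (v ≡ w ⊎ H.Adj v w)
    dom w with u ≟ᶠ w | v ≟ᶠ w | G.adj? u w
    ... | yes u≡w | _       | _      = inj₁ (inj₁ u≡w)
    ... | no _    | yes v≡w | _      = inj₂ (inj₁ v≡w)
    ... | no u≢w  | no _    | no ¬uw = inj₁ (inj₂ (fromCover u≢w ¬uw))
    -- If `w` were adjacent to `v` in `G` too, it would be a common neighbor.
    ... | no _    | no v≢w  | yes uw =
      inj₂ (inj₂ (fromCover v≢w λ vw → ¬common (w , uw , G.symm vw)))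
  ... | no ¬far = inj₁ (near⇒b′g≤3 G near)
    where
    near : ∀ u v → Near G u v
    near u v with u ≟ᶠ v | G.adj? u v | any? (λ w → G.adj? u w ×-dec G.adj? w v)
    ... | yes u≡v | _      | _          = inj₁ u≡v
    ... | no _    | yes uv | _          = inj₂ (inj₁ uv)
    ... | no _    | no _   | yes common = inj₂ (inj₂ common)
    ... | no u≢v  | no ¬uv | no ¬common = contradiction (u , v , u≢v , ¬uv , ¬common) ¬far

  b′g≤3⇒sum≤ : 4 ≤ n → b′g G ≤ 3 → b′g G + b′g H ≤ 2 + n
  b′g≤3⇒sum≤ 4≤n b′gG≤3 with any? (λ u → any? λ v → H.adj? u v)
  ... | yes (u , v , uv) = ≤-trans
    (+-mono-≤ b′gG≤3 (edge⇒b′g≤ H 4≤n uv))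
    -- `3 + (3 + (n ∸ 4))` is `2 + (4 + (n ∸ 4))`, and `4 ≤ n`.
    (≤-reflexive (cong (2 +_) (m+[n∸m]≡n 4≤n)))
  ... | no noEdge        = +-mono-≤ (complete⇒b′g≤2 G complete) (b′g≤n H)
    where
    complete : Complete G
    complete u≢v with cover u≢v
    ... | inj₁ uv = uv
    ... | inj₂ uv = contradiction (_ , _ , uv) noEdge

  -- A vertex isolated in `G` is adjacent in `H` to all others, which leaves none isolated there.
  noIsolated⊎noIsolated : 2 ≤ n → NoIsolated G ⊎ NoIsolated H
  noIsolated⊎noIsolated 2≤n with any? (λ v → all? λ u → ¬? (G.adj? v u))
  ... | yes (v , isolated) = inj₂ nbr
    where
    universal : ∀ {u} → v ≢ u → H.Adj v u
    universal v≢u with cover v≢u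
    ... | inj₁ vu = contradiction vu (isolated _)
    ... | inj₂ vu = vu

    nbr : NoIsolated H
    nbr w with v ≟ᶠ w
    ... | no v≢w = v , H.symm (universal v≢w)
    ... | yes refl with other 2≤n v
    ...   | u , u≢v = u , universal (u≢v ∘ sym)
  ... | no noneIsolated = inj₁ nbr
    where
    nbr : NoIsolated G
    nbr v with any? (G.adj? v)
    ... | yes e = e
    ... | no ¬e = contradiction (v , λ u vu → ¬e (u , vu)) noneIsolated

  noIsolated⇒sum≤ : n ≤ 3 → NoIsolated G → b′g G + b′g H ≤ 2 + n
  noIsolated⇒sum≤ n≤3 nbr = +-mono-≤
    (≤-trans (noIsolated⇒b′g≤ G nbr) (≤-reflexive (cong (2 +_) (m≤n⇒m∸n≡0 n≤3))))
    (b′g≤n H)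

sum≤ : (G H : Graph n) → Cover G H → 2 ≤ n → b′g G + b′g H ≤ 2 + n
sum≤ {n} G H cover 2≤n with n ≤? 3
... | yes n≤3 with noIsolated⊎noIsolated G H cover 2≤n
...   | inj₁ nbr = noIsolated⇒sum≤ G H cover n≤3 nbr
...   | inj₂ nbr = subst (_≤ 2 + n) (+-comm (b′g H) (b′g G))
                     (noIsolated⇒sum≤ H G (swap ∘ cover) n≤3 nbr)
sum≤ {n} G H cover 2≤n | no n≰3 with b′g≤3⊎b′g≤3 G H cover
...   | inj₁ G≤3 = b′g≤3⇒sum≤ G H cover (≰⇒> n≰3) G≤3
...   | inj₂ H≤3 = subst (_≤ 2 + n) (+-comm (b′g H) (b′g G))
                     (b′g≤3⇒sum≤ H G (swap ∘ cover) (≰⇒> n≰3) H≤3)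

theorem13 : ∀ (n : ℕ) → 2 ≤ n → (G : Graph n) →
    (4 ≤ b′g G + b′g (complement G)) × (b′g G + b′g (complement G) ≤ n + 2)
theorem13 n 2≤n G =
  +-mono-≤ (2≤b′g G 2≤n) (2≤b′g (complement G) 2≤n) ,
  subst (b′g G + b′g (complement G) ≤_) (+-comm 2 n)
    (sum≤ G (complement G) (cover-complement G) 2≤n)
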